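{- If $n$ is a positive integer and $p$ is an integer, then $$\sum_{k=1}^n(-1)^{(p-1)(n-k)}\frac{k}{n+k}\binom{n+k}{n-k}L_p^{2k-1}=\frac{F_{2np}}{2F_p}\qquad(p\ne0),$$ $$\sum_{k=1}^n(-1)^{p(n-k)}\frac{k}{n+k}\binom{n+k}{n-k}5^{k-1}F_p^{2k-1}=\frac{F_{2np}}{2L_p}.$$
   Context: $F_n$ and $L_n$ ($n\in\mathbb{Z}$) are the Fibonacci and Lucas numbers: $F_0=0$, $F_1=1$, $F_n=F_{n-1}+F_{n-2}$; $L_0=2$, $L_1=1$, $L_n=L_{n-1}+L_{n-2}$, extended to negative indices by $F_{ -n}=(-1)^{n-1}F_n$, $L_{ -n}=(-1)^nL_n$. -}

module Defs where

open import Data.Fin.Base using (toℕ)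
open import Data.Integer.Base as ℤ using (ℤ; +_; -[1+_]; -1ℤ; 0ℤ; ∣_∣)
open import Data.Integer.Properties using (i*j≢0)
open import Data.Nat.Base as ℕ using (ℕ; zero; suc)
open import Data.Rational.Base using (ℚ)
open import Data.Rational.Properties using (+-0-commutativeMonoid)
open import Relation.Binary.PropositionalEquality.Core using (_≢_)

import Algebra.Properties.CommutativeMonoid.Sum +-0-commutativeMonoid as Sum

fib : ℕ → ℕ
fib zero          = 0
fib (suc zero)    = 1
fib (suc (suc n)) = fib (suc n) ℕ.+ fib n

luc : ℕ → ℕ
luc zero          = 2
luc (suc zero)    = 1
luc (suc (suc n)) = luc (suc n) ℕ.+ luc n

-- Note that -[1+ n ] is -(n + 1), so the sign (-1)^(m-1) of F₋ₘ is (-1)^n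
-- and the sign (-1)^m of L₋ₘ is (-1)^(n+1).

F : ℤ → ℤ
F (+ n)    = + fib n
F -[1+ n ] = (-1ℤ ℤ.^ n) ℤ.* + fib (suc n)

L : ℤ → ℤ
L (+ n)    = + luc n
L -[1+ n ] = (-1ℤ ℤ.^ suc n) ℤ.* + luc (suc n)

-- (-1)^z for an integer exponent z; the absolute value is harmless
-- because -1 is its own inverse.

infix 9 [-1]^_

[-1]^_ : ℤ → ℤ
[-1]^ z = -1ℤ ℤ.^ ∣ z ∣

∑₁ : ℕ → (ℕ → ℚ) → ℚ
∑₁ n f = Sum.sum {n} (λ i → f (suc (toℕ i)))

infixl 5 ∑₁

syntax ∑₁ n (λ k → t) = ∑[1≤ k ≤ n ] t

+-nonZeroˡ : ∀ m n .{{_ : ℕ.NonZero m}} → ℕ.NonZero (m ℕ.+ n)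
+-nonZeroˡ (suc _) _ = _

fib-nonZero : ∀ n → ℕ.NonZero (fib (suc n))
fib-nonZero zero    = _
fib-nonZero (suc n) = +-nonZeroˡ (fib (suc n)) (fib n) {{fib-nonZero n}}

luc-nonZero : ∀ n → ℕ.NonZero (luc n)
luc-nonZero zero          = _
luc-nonZero (suc zero)    = _
luc-nonZero (suc (suc n)) = +-nonZeroˡ (luc (suc n)) (luc n) {{luc-nonZero (suc n)}}

sign-nonZero : ∀ n → ℤ.NonZero (-1ℤ ℤ.^ n)
sign-nonZero zero    = _
sign-nonZero (suc n) = i*j≢0 -1ℤ (-1ℤ ℤ.^ n) {{_}} {{sign-nonZero n}}

F-nonZero : ∀ p .{{_ : ℤ.NonZero p}} → ℤ.NonZero (F p)
F-nonZero (+ suc n) = fib-nonZero n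
F-nonZero -[1+ n ]  =
  i*j≢0 (-1ℤ ℤ.^ n) (+ fib (suc n)) {{sign-nonZero n}} {{fib-nonZero n}}

L-nonZero : ∀ p → ℤ.NonZero (L p)
L-nonZero (+ n)    = luc-nonZero n
L-nonZero -[1+ n ] =
  i*j≢0 (-1ℤ ℤ.^ suc n) (+ luc (suc n)) {{sign-nonZero (suc n)}} {{luc-nonZero (suc n)}}

2F-nonZero : ∀ {p} → p ≢ 0ℤ → ℤ.NonZero (+ 2 ℤ.* F p)
2F-nonZero {p} p≢0 = i*j≢0 (+ 2) (F p) {{_}} {{F-nonZero p {{ℤ.≢-nonZero p≢0}}}}

2L-nonZero : ∀ p → ℤ.NonZero (+ 2 ℤ.* L p)
2L-nonZero p = i*j≢0 (+ 2) (L p) {{_}} {{L-nonZero p}}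

{-# OPTIONS --safe #-}

-- By absorption, k/(n+k) C(n+k, n-k) = C(n+k-1, 2k-1)/2, so with k = j + 1 and n = m + 1 twice
-- either sum is x S m, where S m = Σ_j ε^(m-j) C(m+j+1, 2j+1) y^j, with (x, y, ε) equal to
-- (L_p, L_p², (-1)^(p-1)) or (F_p, 5F_p², (-1)^p).  Pascal's rule couples S to the analogous
-- sums with C(m+j, 2j), and eliminating those gives S (m+2) = (y + 2ε) S (m+1) - S m.
-- In both cases y + 2ε = L_{2p}, which makes this the recurrence of F_{2(m+1)p},
-- whence F_p L_p S m = F_{2(m+1)p}.
module Submission where

open import Defs
open import Data.Integer.Base as ℤ using (ℤ; +_; 0ℤ; 1ℤ)
open import Data.Nat.Base as ℕ using (ℕ)
open import Data.Nat.Combinatorics using (_C_)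
open import Data.Product.Base using (_×_)
open import Data.Rational.Base using (_*_; _/_; _÷_)
open import Data.Rational.Literals using (fromℤ)
open import Relation.Binary.PropositionalEquality.Core using (_≡_; _≢_)

open import Data.Fin.Base as Fin using (Fin; toℕ; inject₁; fromℕ)
import Data.Fin.Properties as Fin
import Data.Integer.Base
open import Data.Integer.Base using (-1ℤ; -[1+_]; ∣_∣)
import Data.Integer.Properties as ℤ
open import Data.Integer.Tactic.RingSolver using (solve-∀)
open import Data.Nat.Base using (zero; suc)
open import Data.Nat.Combinatorics
  using (nCk≡nC[n∸k]; nCk+nC[k+1]≡[n+1]C[k+1]; k>n⇒nCk≡0; nC1≡n)
import Data.Nat.Properties as ℕ
import Data.Nat.Tactic.RingSolver as ℕ-Solver
open import Data.Product.Base using (_,_)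
open import Data.Rational.Base as ℚ using (ℚ; toℚᵘ; 1/_)
import Data.Rational.Properties as ℚ
import Data.Rational.Unnormalised.Base as ℚᵘ
import Data.Rational.Unnormalised.Properties as ℚᵘ
open import Function.Base using (_∘_)
open import Relation.Binary.PropositionalEquality
  using (refl; sym; trans; cong; cong₂; module ≡-Reasoning)

open import Algebra.Bundles using (CommutativeRing)
open import Algebra.Properties.Semiring.Sum
  (CommutativeRing.semiring ℤ.+-*-commutativeRing)
  using (sum; sum-cong-≗; sum-init-last; ∑-distrib-+; *-distribˡ-sum)
import Algebra.Properties.CommutativeMonoid.Sum ℚ.+-0-commutativeMonoid as ℚ-Sum
open import Algebra.Properties.CommutativeSemigroup
  (CommutativeRing.*-commutativeSemigroup ℚ.+-*-commutativeRing)
  using (xy∙z≈xz∙y)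

open ≡-Reasoning

-- Fibonacci and Lucas identities at natural indices.

-- Induction on `m` with `n` free: one unit moves from `m` to `n`, and the Fibonacci recurrence
-- regroups the products.
fib-suc-+ : ∀ m n → fib (suc m ℕ.+ n) ≡ fib (suc m) ℕ.* fib (suc n) ℕ.+ fib m ℕ.* fib n
fib-suc-+ zero    n = eq (fib (suc n))
  where
  eq : ∀ x → x ≡ 1 ℕ.* x ℕ.+ 0
  eq = ℕ-Solver.solve-∀
fib-suc-+ (suc m) n = begin
  fib (suc (suc m) ℕ.+ n)                                      ≡⟨ cong (fib ∘ suc) (ℕ.+-suc m n) ⟨
  fib (suc m ℕ.+ suc n)                                        ≡⟨ fib-suc-+ m (suc n) ⟩
  fib (suc m) ℕ.* fib (suc (suc n)) ℕ.+ fib m ℕ.* fib (suc n)  ≡⟨ eq (fib (suc m)) (fib m) (fib (suc n)) (fib n) ⟩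
  fib (suc (suc m)) ℕ.* fib (suc n) ℕ.+ fib (suc m) ℕ.* fib n  ∎
  where
  eq : ∀ b a d c → b ℕ.* (d ℕ.+ c) ℕ.+ a ℕ.* d ≡ (b ℕ.+ a) ℕ.* d ℕ.+ b ℕ.* c
  eq = ℕ-Solver.solve-∀

-- A subtraction-free form of L_n = F_{n+1} + F_{n-1}: both sides satisfy the Fibonacci recurrence
-- in `n` and agree at 0 and 1.
luc+fib : ∀ n → luc n ℕ.+ fib n ≡ 2 ℕ.* fib (suc n)
luc+fib zero          = refl
luc+fib (suc zero)    = refl
luc+fib (suc (suc n)) = begin
  (luc (suc n) ℕ.+ luc n) ℕ.+ (fib (suc n) ℕ.+ fib n)  ≡⟨ interchange (luc (suc n)) (luc n) (fib (suc n)) (fib n) ⟩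
  (luc (suc n) ℕ.+ fib (suc n)) ℕ.+ (luc n ℕ.+ fib n)  ≡⟨ cong₂ ℕ._+_ (luc+fib (suc n)) (luc+fib n) ⟩
  2 ℕ.* fib (suc (suc n)) ℕ.+ 2 ℕ.* fib (suc n)        ≡⟨ ℕ.*-distribˡ-+ 2 (fib (suc (suc n))) (fib (suc n)) ⟨
  2 ℕ.* fib (suc (suc (suc n)))                        ∎
  where
  interchange : ∀ a b c d → (a ℕ.+ b) ℕ.+ (c ℕ.+ d) ≡ (a ℕ.+ c) ℕ.+ (b ℕ.+ d)
  interchange = ℕ-Solver.solve-∀

module _ where
  open Data.Integer.Base using (_+_; _-_; -_; _^_) renaming (_*_ to _·_)

  fℤ lℤ : ℕ → ℤ
  fℤ n = + fib n
  lℤ n = + luc n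

  fℤ-suc-+ : ∀ m n → fℤ (suc m ℕ.+ n) ≡ fℤ (suc m) · fℤ (suc n) + fℤ m · fℤ n
  fℤ-suc-+ m n = begin
    fℤ (suc m ℕ.+ n)                                          ≡⟨ cong +_ (fib-suc-+ m n) ⟩
    + (fib (suc m) ℕ.* fib (suc n)) + + (fib m ℕ.* fib n)     ≡⟨ cong₂ _+_ (ℤ.pos-* (fib (suc m)) (fib (suc n))) (ℤ.pos-* (fib m) (fib n)) ⟩
    fℤ (suc m) · fℤ (suc n) + fℤ m · fℤ n                     ∎

  -- The coefficient `fℤ (suc m) - fℤ m` is F_{m-1}, written so that `m = 0` needs no separate case.
  -- The formula is the difference of two consecutive instances of `fℤ-suc-+`.
  fℤ-+ : ∀ m n → fℤ (m ℕ.+ n) ≡ fℤ m · fℤ (suc n) + (fℤ (suc m) - fℤ m) · fℤ n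
  fℤ-+ m n = begin
    fℤ (m ℕ.+ n)                                                     ≡⟨ difference (fℤ (suc (m ℕ.+ n))) (fℤ (m ℕ.+ n)) ⟩
    fℤ (suc (suc m) ℕ.+ n) - fℤ (suc m ℕ.+ n)                        ≡⟨ cong₂ _-_ (fℤ-suc-+ (suc m) n) (fℤ-suc-+ m n) ⟩
    ((fℤ (suc m) + fℤ m) · fℤ (suc n) + fℤ (suc m) · fℤ n)
      - (fℤ (suc m) · fℤ (suc n) + fℤ m · fℤ n)                      ≡⟨ eq (fℤ (suc m)) (fℤ m) (fℤ (suc n)) (fℤ n) ⟩
    fℤ m · fℤ (suc n) + (fℤ (suc m) - fℤ m) · fℤ n                   ∎
    where
    difference : ∀ x y → y ≡ (x + y) - x
    difference = solve-∀
    eq : ∀ b a d c → ((b + a) · d + b · c) - (b · d + a · c) ≡ a · d + (b - a) · c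
    eq = solve-∀

  -- Lucas numbers are eliminated in favour of the pair b = F_{n+1}, a = F_n. Together with
  -- `cassini` for the signs, this turns the identities below into polynomial identities in b and a.
  lℤ-fℤ : ∀ n → lℤ n ≡ fℤ (suc n) + fℤ (suc n) - fℤ n
  lℤ-fℤ n = begin
    lℤ n                              ≡⟨ difference (lℤ n) (fℤ n) ⟩
    (lℤ n + fℤ n) - fℤ n              ≡⟨ cong (λ z → + z - fℤ n) (luc+fib n) ⟩
    + (2 ℕ.* fib (suc n)) - fℤ n      ≡⟨ cong (λ z → + (fib (suc n) ℕ.+ z) - fℤ n) (ℕ.+-identityʳ (fib (suc n))) ⟩
    fℤ (suc n) + fℤ (suc n) - fℤ n    ∎
    where
    difference : ∀ x y → x ≡ (x + y) - y
    difference = solve-∀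

  -- The index shift sends (b, a) to (b + a, b), and this substitution negates the quadratic form b²
  -- - ba - a².
  cassini : ∀ n → fℤ (suc n) · fℤ (suc n) - fℤ (suc n) · fℤ n - fℤ n · fℤ n ≡ -1ℤ ^ n
  cassini zero    = refl
  cassini (suc n) = trans (eq (fℤ (suc n)) (fℤ n)) (cong (-1ℤ ·_) (cassini n))
    where
    eq : ∀ b a → (b + a) · (b + a) - (b + a) · b - b · b ≡ -1ℤ · (b · b - b · a - a · a)
    eq = solve-∀

  involution-^ : ∀ {ε} → ε · ε ≡ 1ℤ → ∀ n → ε ^ n · ε ^ n ≡ 1ℤ
  involution-^     ε²≡1 zero    = refl
  involution-^ {ε} ε²≡1 (suc n) = trans (eq ε (ε ^ n)) (cong₂ _·_ ε²≡1 (involution-^ ε²≡1 n))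
    where
    eq : ∀ ε s → (ε · s) · (ε · s) ≡ (ε · ε) · (s · s)
    eq = solve-∀

  involution-^-double : ∀ {ε} → ε · ε ≡ 1ℤ → ∀ n → ε ^ (n ℕ.+ n) ≡ 1ℤ
  involution-^-double {ε} ε²≡1 n = trans (ℤ.^-distribˡ-+-* ε n n) (involution-^ ε²≡1 n)

  fℤ-double : ∀ q → fℤ (q ℕ.+ q) ≡ fℤ q · lℤ q
  fℤ-double q = begin
    fℤ (q ℕ.+ q)                                        ≡⟨ fℤ-+ q q ⟩
    fℤ q · fℤ (suc q) + (fℤ (suc q) - fℤ q) · fℤ q      ≡⟨ eq (fℤ (suc q)) (fℤ q) ⟩
    fℤ q · (fℤ (suc q) + fℤ (suc q) - fℤ q)             ≡⟨ cong (fℤ q ·_) (lℤ-fℤ q) ⟨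
    fℤ q · lℤ q                                         ∎
    where
    eq : ∀ b a → a · b + (b - a) · a ≡ a · (b + b - a)
    eq = solve-∀

  -- The normal form 2b² - 2ba + 3a² at which the two evaluations of y + 2ε, `lℤ²-sign` and
  -- `5fℤ²+sign`, both arrive.
  lℤ-double : ∀ q → lℤ (q ℕ.+ q) ≡
    fℤ (suc q) · fℤ (suc q) + fℤ (suc q) · fℤ (suc q)
      - (fℤ (suc q) · fℤ q + fℤ (suc q) · fℤ q) + (fℤ q · fℤ q + fℤ q · fℤ q + fℤ q · fℤ q)
  lℤ-double q = begin
    lℤ (q ℕ.+ q)                                                    ≡⟨ lℤ-fℤ (q ℕ.+ q) ⟩
    fℤ (suc q ℕ.+ q) + fℤ (suc q ℕ.+ q) - fℤ (q ℕ.+ q)              ≡⟨ cong₂ (λ x y → x + x - y) (fℤ-suc-+ q q) (fℤ-+ q q) ⟩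
    (b · b + a · a) + (b · b + a · a) - (a · b + (b - a) · a)       ≡⟨ eq b a ⟩
    _                                                               ∎
    where
    b = fℤ (suc q)
    a = fℤ q
    eq : ∀ b a → (b · b + a · a) + (b · b + a · a) - (a · b + (b - a) · a)
         ≡ b · b + b · b - (b · a + b · a) + (a · a + a · a + a · a)
    eq = solve-∀

  lℤ²-sign : ∀ q → lℤ q ^ 2 + (- (-1ℤ ^ q) + - (-1ℤ ^ q)) ≡ lℤ (q ℕ.+ q)
  lℤ²-sign q = begin
    -- Cassini is read backwards: replacing the sign by a quadratic form makes every term
    -- homogeneous of degree 2 in b and a.
    lℤ q ^ 2 + (- (-1ℤ ^ q) + - (-1ℤ ^ q))  ≡⟨ cong₂ (λ l s → l ^ 2 + (- s + - s)) (lℤ-fℤ q) (sym (cassini q)) ⟩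
    _                                       ≡⟨ eq (fℤ (suc q)) (fℤ q) ⟩
    _                                       ≡⟨ lℤ-double q ⟨
    lℤ (q ℕ.+ q)                            ∎
    where
    eq : ∀ b a → (b + b - a) · ((b + b - a) · 1ℤ)
           + (- (b · b - b · a - a · a) + - (b · b - b · a - a · a))
         ≡ b · b + b · b - (b · a + b · a) + (a · a + a · a + a · a)
    eq = solve-∀

  5fℤ²+sign : ∀ q → + 5 · fℤ q ^ 2 + (-1ℤ ^ q + -1ℤ ^ q) ≡ lℤ (q ℕ.+ q)
  5fℤ²+sign q = begin
    + 5 · fℤ q ^ 2 + (-1ℤ ^ q + -1ℤ ^ q)  ≡⟨ cong (λ s → + 5 · fℤ q ^ 2 + (s + s)) (sym (cassini q)) ⟩
    _                                     ≡⟨ eq (fℤ (suc q)) (fℤ q) ⟩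
    _                                     ≡⟨ lℤ-double q ⟨
    lℤ (q ℕ.+ q)                          ∎
    where
    eq : ∀ b a → + 5 · (a · (a · 1ℤ))
           + ((b · b - b · a - a · a) + (b · b - b · a - a · a))
         ≡ b · b + b · b - (b · a + b · a) + (a · a + a · a + a · a)
    eq = solve-∀

  -- The `t`-th power of the Fibonacci matrix has trace L_t and determinant (-1)^t, and the
  -- determinant is 1 since `t = q + q` is even. This is its characteristic equation applied to the
  -- sequence.
  fℤ-recurrence : ∀ q m → let t = q ℕ.+ q in
    fℤ (t ℕ.+ (t ℕ.+ m)) ≡ lℤ t · fℤ (t ℕ.+ m) - fℤ m
  fℤ-recurrence q m = begin
    fℤ (t ℕ.+ (t ℕ.+ m))
      ≡⟨ fℤ-+ t (t ℕ.+ m) ⟩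
    a · fℤ (suc t ℕ.+ m) + (b - a) · fℤ (t ℕ.+ m)
      ≡⟨ cong₂ (λ x y → a · x + (b - a) · y) (fℤ-suc-+ t m) (fℤ-+ t m) ⟩
    a · (b · d + a · c) + (b - a) · (a · d + (b - a) · c)
      ≡⟨ eq b a d c ⟩
    (b + b - a) · (a · d + (b - a) · c) - (b · b - b · a - a · a) · c
      -- The coefficient of `c` is the Cassini form at the even index `t`, hence 1.
      ≡⟨ cong₂ (λ x y → x - y · c) (cong₂ _·_ (sym (lℤ-fℤ t)) (sym (fℤ-+ t m))) (trans (cassini t) (involution-^-double { -1ℤ} refl q)) ⟩
    lℤ t · fℤ (t ℕ.+ m) - 1ℤ · c
      ≡⟨ cong (λ x → lℤ t · fℤ (t ℕ.+ m) - x) (ℤ.*-identityˡ c) ⟩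
    lℤ t · fℤ (t ℕ.+ m) - c
      ∎
    where
    t = q ℕ.+ q
    a = fℤ t
    b = fℤ (suc t)
    c = fℤ m
    d = fℤ (suc m)
    eq : ∀ b a d c → a · (b · d + a · c) + (b - a) · (a · d + (b - a) · c)
         ≡ (b + b - a) · (a · d + (b - a) · c) - (b · b - b · a - a · a) · c
    eq = solve-∀

  -- The signed binomial sums and their recurrence.

  -- As ε² = 1, the sign ε^(m - j) is written ε^(m + j), so that no truncated subtraction occurs.
  module Sums (ε y : ℤ) (ε²≡1 : ε · ε ≡ 1ℤ) where

    odd even : ℕ → ℕ → ℤ
    odd  m j = ε ^ (m ℕ.+ j) · + (suc (m ℕ.+ j) C suc (j ℕ.+ j)) · y ^ j
    even m j = ε ^ (m ℕ.+ j) · + ((m ℕ.+ j) C (j ℕ.+ j)) · y ^ j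

    -- For ε = 1 and `N > m` these are the Morgan-Voyce polynomials B_m and b_m at `y`. The number
    -- of terms `N` is independent of `m`, so that sums with different `m` can be combined termwise;
    -- surplus terms vanish.
    U V : ℕ → ℕ → ℤ
    U N m = sum {N} (odd m ∘ toℕ)
    V N m = sum {N} (even m ∘ toℕ)

    sum-linear : ∀ {N} c (f g : Fin N → ℤ) → sum (λ i → c · f i + g i) ≡ c · sum f + sum g
    sum-linear c f g = trans (∑-distrib-+ (λ i → c · f i) g) (cong (_+ sum g) (sym (*-distribˡ-sum c f)))

    -- Pascal's rule for C(m+j+2, 2j+1); the part with lower index 2j is the `even` term.
    odd-suc : ∀ m j → odd (suc m) j ≡ ε · odd m j + even (suc m) j
    odd-suc m j = begin
      ε · e · + (suc (suc i) C suc k) · z                         ≡⟨ cong (λ x → ε · e · + x · z) (sym (nCk+nC[k+1]≡[n+1]C[k+1] (suc i) k)) ⟩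
      ε · e · (+ (suc i C k) + + (suc i C suc k)) · z             ≡⟨ eq ε e (+ (suc i C k)) (+ (suc i C suc k)) z ⟩
      ε · (e · + (suc i C suc k) · z) + ε · e · + (suc i C k) · z ∎
      where
      i = m ℕ.+ j
      k = j ℕ.+ j
      e = ε ^ i
      z = y ^ j
      eq : ∀ ε e c d z → ε · e · (c + d) · z ≡ ε · (e · d · z) + ε · e · c · z
      eq = solve-∀

    -- Pascal's rule for C(m+j+2, 2j+2). The part with lower index 2j+1 is an `odd` term at `j`, so
    -- it carries an extra factor `y` and a surplus ε², which is 1.
    even-suc : ∀ m j → even (suc m) (suc j) ≡ ε · even m (suc j) + y · odd m j
    even-suc m j = begin
      ε · ε ^ (m ℕ.+ suc j) · + (suc (m ℕ.+ suc j) C suc (j ℕ.+ suc j)) · (y · z)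
        ≡⟨ cong (λ x → ε · ε ^ (m ℕ.+ suc j) · + x · (y · z)) (sym (nCk+nC[k+1]≡[n+1]C[k+1] (m ℕ.+ suc j) (j ℕ.+ suc j))) ⟩
      ε · ε ^ (m ℕ.+ suc j) · (+ ((m ℕ.+ suc j) C (j ℕ.+ suc j)) + D) · (y · z)
        ≡⟨ cong₂ (λ a b → ε · ε ^ a · (+ (a C b) + D) · (y · z)) (ℕ.+-suc m j) (ℕ.+-suc j j) ⟩
      ε · (ε · e) · (c + D) · (y · z)
        ≡⟨ eq ε e c D y z ⟩
      ε · ((ε · e) · D · (y · z)) + ε · ε · (y · (e · c · z))
        ≡⟨ cong₂ (λ a b → ε · (ε ^ a · D · (y · z)) + b · (y · (e · c · z))) (sym (ℕ.+-suc m j)) ε²≡1 ⟩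
      ε · even m (suc j) + 1ℤ · (y · odd m j)
        ≡⟨ cong (λ x → ε · even m (suc j) + x) (ℤ.*-identityˡ (y · odd m j)) ⟩
      ε · even m (suc j) + y · odd m j
        ∎
      where
      e = ε ^ (m ℕ.+ j)
      z = y ^ j
      D = + ((m ℕ.+ suc j) C suc (j ℕ.+ suc j))
      c = + (suc (m ℕ.+ j) C suc (j ℕ.+ j))
      eq : ∀ ε e c d y z → ε · (ε · e) · (c + d) · (y · z)
           ≡ ε · ((ε · e) · d · (y · z)) + ε · ε · (y · (e · c · z))
      eq = solve-∀

    U-suc : ∀ N m → U N (suc m) ≡ ε · U N m + V N (suc m)
    U-suc N m = trans (sum-cong-≗ {N} (odd-suc m ∘ toℕ)) (sum-linear {N} ε (odd m ∘ toℕ) (even (suc m) ∘ toℕ))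

    -- Since `even-suc` lowers `j` by one, `U` has one term fewer than `V`. The term at 0 has
    -- binomial coefficient 1 and only gains a factor ε.
    V-suc : ∀ N m → V (suc N) (suc m) ≡ ε · V (suc N) m + y · U N m
    V-suc N m = begin
      even (suc m) 0 + sum {N} (even (suc m) ∘ suc ∘ toℕ)
        ≡⟨ cong (λ x → even (suc m) 0 + x) (sum-cong-≗ {N} (even-suc m ∘ toℕ)) ⟩
      even (suc m) 0 + sum {N} (λ i → ε · even m (suc (toℕ i)) + y · odd m (toℕ i))
        ≡⟨ cong (λ x → even (suc m) 0 + x) (sum-linear {N} ε _ _) ⟩
      even (suc m) 0 + (ε · s + sum {N} (λ i → y · odd m (toℕ i)))
        ≡⟨ cong (λ x → even (suc m) 0 + (ε · s + x)) (sym (*-distribˡ-sum {N} y (odd m ∘ toℕ))) ⟩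
      ε · ε ^ (m ℕ.+ 0) · 1ℤ · 1ℤ + (ε · s + y · U N m)
        ≡⟨ eq ε (ε ^ (m ℕ.+ 0)) s (y · U N m) ⟩
      ε · (ε ^ (m ℕ.+ 0) · 1ℤ · 1ℤ + s) + y · U N m
        ∎
      where
      s = sum {N} (even m ∘ suc ∘ toℕ)
      eq : ∀ ε e s x → ε · e · 1ℤ · 1ℤ + (ε · s + x) ≡ ε · (e · 1ℤ · 1ℤ + s) + x
      eq = solve-∀

    -- The additional term contains C(m+N+1, 2N+1), which is 0 when `m < N`.
    U-stable : ∀ {N m} → m ℕ.< N → U (suc N) m ≡ U N m
    U-stable {N} {m} m<N = begin
      U (suc N) m                                           ≡⟨ sum-init-last {N} (odd m ∘ toℕ) ⟩
      sum {N} (odd m ∘ toℕ ∘ inject₁) + odd m (toℕ (fromℕ N)) ≡⟨ cong₂ _+_ (sum-cong-≗ {N} (cong (odd m) ∘ Fin.toℕ-inject₁)) (cong (odd m) (Fin.toℕ-fromℕ N)) ⟩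
      U N m + odd m N                                       ≡⟨ cong (λ x → U N m + ε ^ (m ℕ.+ N) · + x · y ^ N) (k>n⇒nCk≡0 (ℕ.s<s (ℕ.+-monoˡ-< N m<N))) ⟩
      U N m + ε ^ (m ℕ.+ N) · 0ℤ · y ^ N                    ≡⟨ eq (U N m) (ε ^ (m ℕ.+ N)) (y ^ N) ⟩
      U N m                                                 ∎
      where
      eq : ∀ u e z → u + e · 0ℤ · z ≡ u
      eq = solve-∀

    S : ℕ → ℤ
    S m = U (suc m) m

    S-recurrence : ∀ m → S (suc (suc m)) ≡ (y + (ε + ε)) · S (suc m) - S m
    S-recurrence m = begin
      U (suc N) (suc (suc m))
        ≡⟨ U-suc (suc N) (suc m) ⟩
      ε · u + V (suc N) (suc (suc m))
        ≡⟨ cong (λ x → ε · u + x) (V-suc N (suc m)) ⟩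
      ε · u + (ε · v + y · S (suc m))
        -- Adding and subtracting `ε · U (suc N) m` prepares `v` for elimination: by `U-suc` it
        -- equals `u - ε · U (suc N) m`.
        ≡⟨ eq ε u v (y · S (suc m)) (U (suc N) m) ⟩
      ε · u + (ε · ((ε · U (suc N) m + v) - ε · U (suc N) m) + y · S (suc m))
        ≡⟨ cong (λ x → ε · u + (ε · (x - ε · U (suc N) m) + y · S (suc m))) (sym (U-suc (suc N) m)) ⟩
      ε · u + (ε · (u - ε · U (suc N) m) + y · S (suc m))
        -- Both sums have `m + 3` terms; one vanishing term is dropped to reach `S (suc m)`, two to
        -- reach `S m`.
        ≡⟨ cong₂ (λ u w → ε · u + (ε · (u - ε · w) + y · S (suc m)))
                 (U-stable {N} (ℕ.n<1+n (suc m)))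
                 (trans (U-stable {N} (ℕ.m<n⇒m<1+n (ℕ.n<1+n m))) (U-stable {suc m} (ℕ.n<1+n m))) ⟩
      ε · S (suc m) + (ε · (S (suc m) - ε · S m) + y · S (suc m))
        ≡⟨ eq′ ε y (S (suc m)) (S m) ⟩
      (y + (ε + ε)) · S (suc m) - (ε · ε) · S m
        ≡⟨ cong (λ x → (y + (ε + ε)) · S (suc m) - x) (trans (cong (_· S m) ε²≡1) (ℤ.*-identityˡ (S m))) ⟩
      (y + (ε + ε)) · S (suc m) - S m
        ∎
      where
      N = suc (suc m)
      u = U (suc N) (suc m)
      v = V (suc N) (suc m)
      eq : ∀ ε u v x w → ε · u + (ε · v + x) ≡ ε · u + (ε · ((ε · w + v) - ε · w) + x)
      eq = solve-∀
      eq′ : ∀ ε y s w → ε · s + (ε · (s - ε · w) + y · s) ≡ (y + (ε + ε)) · s - (ε · ε) · w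
      eq′ = solve-∀

    S-one : S 1 ≡ y + (ε + ε)
    S-one = begin
      -- The two terms evaluate by computation, with C(2,1) = 2 and C(3,3) = 1.
      S 1                    ≡⟨ eq ε y ⟩
      (ε · ε) · y + (ε + ε)  ≡⟨ cong (λ x → x · y + (ε + ε)) ε²≡1 ⟩
      1ℤ · y + (ε + ε)       ≡⟨ cong (_+ (ε + ε)) (ℤ.*-identityˡ y) ⟩
      y + (ε + ε)            ∎
      where
      eq : ∀ ε y → (ε · 1ℤ) · + 2 · 1ℤ + ((ε · (ε · 1ℤ)) · 1ℤ · (y · 1ℤ) + 0ℤ) ≡ (ε · ε) · y + (ε + ε)
      eq = solve-∀

    -- Both sides satisfy the recurrence with coefficient L_{2q} and have the same first two values.
    -- Multiplying by F_{2q} instead of dividing keeps `q = 0` included.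
    S-fib : ∀ q → y + (ε + ε) ≡ lℤ (q ℕ.+ q) → ∀ m →
      fℤ (q ℕ.+ q) · S m ≡ fℤ (suc m ℕ.* (q ℕ.+ q))
    S-fib q trace = go
      where
      t = q ℕ.+ q
      go : ∀ m → fℤ t · S m ≡ fℤ (suc m ℕ.* t)
      go zero          = trans (ℤ.*-identityʳ (fℤ t)) (cong fℤ (sym (ℕ.+-identityʳ t)))
      go (suc zero)    = begin
        fℤ t · S 1                           ≡⟨ cong (fℤ t ·_) (trans S-one trace) ⟩
        fℤ t · lℤ t                          ≡⟨ eq (fℤ t) (lℤ t) ⟩
        lℤ t · fℤ t - 0ℤ                     ≡⟨ cong (λ x → lℤ t · fℤ x - 0ℤ) (ℕ.+-identityʳ t) ⟨
        lℤ t · fℤ (t ℕ.+ 0) - 0ℤ             ≡⟨ fℤ-recurrence q 0 ⟨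
        fℤ (t ℕ.+ (t ℕ.+ 0))                 ∎
        where
        eq : ∀ a l → a · l ≡ l · a - 0ℤ
        eq = solve-∀
      go (suc (suc m)) = begin
        fℤ t · S (suc (suc m))                                ≡⟨ cong (fℤ t ·_) (S-recurrence m) ⟩
        fℤ t · ((y + (ε + ε)) · S (suc m) - S m)              ≡⟨ cong (λ l → fℤ t · (l · S (suc m) - S m)) trace ⟩
        fℤ t · (lℤ t · S (suc m) - S m)                       ≡⟨ eq (fℤ t) (lℤ t) (S (suc m)) (S m) ⟩
        lℤ t · (fℤ t · S (suc m)) - fℤ t · S m                ≡⟨ cong₂ (λ x y → lℤ t · x - y) (go (suc m)) (go m) ⟩
        lℤ t · fℤ (suc (suc m) ℕ.* t) - fℤ (suc m ℕ.* t)      ≡⟨ fℤ-recurrence q (suc m ℕ.* t) ⟨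
        fℤ (suc (suc (suc m)) ℕ.* t)                          ∎
        where
        eq : ∀ a l u w → a · (l · u - w) ≡ l · (a · u) - a · w
        eq = solve-∀

  -- Signs, odd powers and negative indices.

  -- With n = m + 1 and k = j + 1 the difference n - k is m - j; multiplying by ε^(2j) = 1 turns
  -- this exponent into m + j.
  sign-quotient : ∀ z {m j} → j ℕ.≤ m →
    [-1]^ (z · (+ suc m - + suc j)) ≡ ([-1]^ z) ^ (m ℕ.+ j)
  sign-quotient z {m} {j} j≤m = begin
    -1ℤ ^ ∣ z · (suc m ℤ.⊖ suc j) ∣         ≡⟨ cong (-1ℤ ^_) (ℤ.abs-* z (suc m ℤ.⊖ suc j)) ⟩
    -1ℤ ^ (∣ z ∣ ℕ.* ∣ suc m ℤ.⊖ suc j ∣)   ≡⟨ cong (λ x → -1ℤ ^ (∣ z ∣ ℕ.* ∣ x ∣)) (ℤ.⊖-≥ (ℕ.s≤s j≤m)) ⟩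
    -1ℤ ^ (∣ z ∣ ℕ.* (m ℕ.∸ j))             ≡⟨ ℤ.^-*-assoc -1ℤ ∣ z ∣ (m ℕ.∸ j) ⟨
    ε ^ (m ℕ.∸ j)                           ≡⟨ ℤ.*-identityʳ (ε ^ (m ℕ.∸ j)) ⟨
    ε ^ (m ℕ.∸ j) · 1ℤ                      ≡⟨ cong (ε ^ (m ℕ.∸ j) ·_) (involution-^-double (involution-^ { -1ℤ} refl ∣ z ∣) j) ⟨
    ε ^ (m ℕ.∸ j) · ε ^ (j ℕ.+ j)           ≡⟨ ℤ.^-distribˡ-+-* ε (m ℕ.∸ j) (j ℕ.+ j) ⟨
    ε ^ (m ℕ.∸ j ℕ.+ (j ℕ.+ j))             ≡⟨ cong (ε ^_) (ℕ.+-assoc (m ℕ.∸ j) j j) ⟨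
    ε ^ (m ℕ.∸ j ℕ.+ j ℕ.+ j)               ≡⟨ cong (λ x → ε ^ (x ℕ.+ j)) (ℕ.m∸n+n≡m j≤m) ⟩
    ε ^ (m ℕ.+ j)                           ∎
    where ε = [-1]^ z

  -- The cases differ because `∣ p - 1ℤ ∣` is one less than `∣ p ∣` for positive `p` and one more
  -- otherwise.
  sign-pred : ∀ p → [-1]^ (p - 1ℤ) ≡ - ([-1]^ p)
  sign-pred (+ zero)  = refl
  sign-pred (+ suc n) = trans (cong (λ k → -1ℤ ^ ∣ k ∣) (ℤ.⊖-≥ (ℕ.s≤s (ℕ.z≤n {n})))) (eq (-1ℤ ^ n))
    where
    eq : ∀ s → s ≡ - (-1ℤ · s)
    eq = solve-∀
  sign-pred -[1+ n ]  = trans (cong (λ k → -1ℤ ^ suc (suc k)) (ℕ.+-identityʳ n)) (eq (-1ℤ ^ suc n))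
    where
    eq : ∀ s → -1ℤ · s ≡ - s
    eq = solve-∀

  -- For k = j + 1 the exponent 2k - 1 is 2j + 1: one factor `x` leaves the sum and the rest becomes
  -- a power of the square.
  odd-power : ∀ x j → x ^ (2 ℕ.* suc j ℕ.∸ 1) ≡ x · (x ^ 2) ^ j
  odd-power x j = begin
    x ^ (j ℕ.+ suc (j ℕ.+ 0))  ≡⟨ cong (x ^_) (ℕ.+-suc j (j ℕ.+ 0)) ⟩
    x · x ^ (2 ℕ.* j)          ≡⟨ cong (x ·_) (ℤ.^-*-assoc x 2 j) ⟨
    x · (x ^ 2) ^ j            ∎

  ^-distrib-· : ∀ x y n → (x · y) ^ n ≡ x ^ n · y ^ n
  ^-distrib-· x y zero    = refl
  ^-distrib-· x y (suc n) = trans (cong (x · y ·_) (^-distrib-· x y n)) (eq x y (x ^ n) (y ^ n))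
    where
    eq : ∀ x y a b → (x · y) · (a · b) ≡ (x · a) · (y · b)
    eq = solve-∀

  F-neg-even : ∀ k → F (- (+ (k ℕ.+ k))) ≡ - fℤ (k ℕ.+ k)
  F-neg-even zero    = refl
  F-neg-even (suc k) = trans (cong (_· fℤ (suc (k ℕ.+ suc k))) sign) (ℤ.-1*i≡-i (fℤ (suc (k ℕ.+ suc k))))
    where
    sign : -1ℤ ^ (k ℕ.+ suc k) ≡ -1ℤ
    sign = trans (cong (-1ℤ ^_) (ℕ.+-suc k k)) (cong (-1ℤ ·_) (involution-^-double { -1ℤ} refl k))

  -- The sign at a negative index disappears on squaring, so `y` depends only on `∣ p ∣`; the same
  -- holds for `L²-abs`.
  F²-abs : ∀ p → F p ^ 2 ≡ fℤ ∣ p ∣ ^ 2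
  F²-abs (+ n)    = refl
  F²-abs -[1+ n ] = begin
    (-1ℤ ^ n · fℤ (suc n)) ^ 2         ≡⟨ eq (-1ℤ ^ n) (fℤ (suc n)) ⟩
    -1ℤ ^ n · -1ℤ ^ n · fℤ (suc n) ^ 2 ≡⟨ cong (_· fℤ (suc n) ^ 2) (involution-^ { -1ℤ} refl n) ⟩
    1ℤ · fℤ (suc n) ^ 2                ≡⟨ ℤ.*-identityˡ (fℤ (suc n) ^ 2) ⟩
    fℤ (suc n) ^ 2                     ∎
    where
    eq : ∀ s a → (s · a) · ((s · a) · 1ℤ) ≡ s · s · (a · (a · 1ℤ))
    eq = solve-∀

  L²-abs : ∀ p → L p ^ 2 ≡ lℤ ∣ p ∣ ^ 2
  L²-abs (+ n)    = refl
  L²-abs -[1+ n ] = begin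
    (-1ℤ ^ suc n · lℤ (suc n)) ^ 2             ≡⟨ eq (-1ℤ ^ suc n) (lℤ (suc n)) ⟩
    -1ℤ ^ suc n · -1ℤ ^ suc n · lℤ (suc n) ^ 2 ≡⟨ cong (_· lℤ (suc n) ^ 2) (involution-^ { -1ℤ} refl (suc n)) ⟩
    1ℤ · lℤ (suc n) ^ 2                        ≡⟨ ℤ.*-identityˡ (lℤ (suc n) ^ 2) ⟩
    lℤ (suc n) ^ 2                             ∎
    where
    eq : ∀ s a → (s · a) · ((s · a) · 1ℤ) ≡ s · s · (a · (a · 1ℤ))
    eq = solve-∀

  F-multiple : ∀ n q → F (+ 2 · + n · + q) ≡ fℤ (n ℕ.* (q ℕ.+ q))
  F-multiple n q = cong F (begin
    + 2 · + n · + q         ≡⟨ cong (_· + q) (ℤ.pos-* 2 n) ⟨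
    + (2 ℕ.* n) · + q       ≡⟨ ℤ.pos-* (2 ℕ.* n) q ⟨
    + (2 ℕ.* n ℕ.* q)       ≡⟨ cong +_ (eq n q) ⟩
    + (n ℕ.* (q ℕ.+ q))     ∎)
    where
    eq : ∀ n q → 2 ℕ.* n ℕ.* q ≡ n ℕ.* (q ℕ.+ q)
    eq = ℕ-Solver.solve-∀

  F-multiple-neg : ∀ n q → F (+ 2 · + n · - (+ q)) ≡ - fℤ (n ℕ.* (q ℕ.+ q))
  F-multiple-neg n q = begin
    F (+ 2 · + n · - (+ q))             ≡⟨ cong F (ℤ.neg-distribʳ-* (+ 2 · + n) (+ q)) ⟨
    F (- (+ 2 · + n · + q))             ≡⟨ cong (λ x → F (- (x · + q))) (ℤ.pos-* 2 n) ⟨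
    F (- (+ (2 ℕ.* n) · + q))           ≡⟨ cong (F ∘ -_) (ℤ.pos-* (2 ℕ.* n) q) ⟨
    F (- (+ (2 ℕ.* n ℕ.* q)))           ≡⟨ cong (λ x → F (- (+ x))) (eq n q) ⟩
    F (- (+ (n ℕ.* q ℕ.+ n ℕ.* q)))     ≡⟨ F-neg-even (n ℕ.* q) ⟩
    - fℤ (n ℕ.* q ℕ.+ n ℕ.* q)          ≡⟨ cong (λ x → - fℤ x) (ℕ.*-distribˡ-+ n q q) ⟨
    - fℤ (n ℕ.* (q ℕ.+ q))              ∎
    where
    eq : ∀ n q → 2 ℕ.* n ℕ.* q ≡ n ℕ.* q ℕ.+ n ℕ.* q
    eq = ℕ-Solver.solve-∀

  module _ (ε y : ℤ) (ε²≡1 : ε · ε ≡ 1ℤ) where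
    open Sums ε y ε²≡1

    -- As F_p L_p = F_{2p}, this is `S-fib` for an integer index. For negative `p` the signs of F_p
    -- and L_p multiply to -1, and F at the even index 2(m+1)p changes sign as well.
    S-F : ∀ p → y + (ε + ε) ≡ lℤ (∣ p ∣ ℕ.+ ∣ p ∣) → ∀ m →
      F p · L p · S m ≡ F (+ 2 · + suc m · p)
    S-F (+ q) trace m = begin
      fℤ q · lℤ q · S m               ≡⟨ cong (_· S m) (fℤ-double q) ⟨
      fℤ (q ℕ.+ q) · S m              ≡⟨ S-fib q trace m ⟩
      fℤ (suc m ℕ.* (q ℕ.+ q))        ≡⟨ F-multiple (suc m) q ⟨
      F (+ 2 · + suc m · + q)         ∎
    S-F -[1+ q′ ] trace m = begin
      (-1ℤ ^ q′ · fℤ q) · (-1ℤ ^ q · lℤ q) · S m          ≡⟨ eq (-1ℤ ^ q′) (fℤ q) (lℤ q) (S m) ⟩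
      - (-1ℤ ^ q′ · -1ℤ ^ q′ · (fℤ q · lℤ q · S m))       ≡⟨ cong₂ (λ x z → - (x · (z · S m))) (involution-^ { -1ℤ} refl q′) (sym (fℤ-double q)) ⟩
      - (1ℤ · (fℤ (q ℕ.+ q) · S m))                       ≡⟨ cong -_ (ℤ.*-identityˡ (fℤ (q ℕ.+ q) · S m)) ⟩
      - (fℤ (q ℕ.+ q) · S m)                              ≡⟨ cong -_ (S-fib q trace m) ⟩
      - fℤ (suc m ℕ.* (q ℕ.+ q))                          ≡⟨ F-multiple-neg (suc m) q ⟨
      F (+ 2 · + suc m · -[1+ q′ ])                       ∎
      where
      q = suc q′
      eq : ∀ s a l u → (s · a) · ((-1ℤ · s) · l) · u ≡ - (s · s · (a · l · u))
      eq = solve-∀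

  -- Absorption for binomial coefficients.

  absorption : ∀ n k → suc k ℕ.* (suc n C suc k) ≡ suc n ℕ.* (n C k)
  absorption zero    zero    = refl
  absorption zero    (suc k) = begin
    suc (suc k) ℕ.* (1 C suc (suc k))  ≡⟨ cong (suc (suc k) ℕ.*_) (k>n⇒nCk≡0 {1} {suc (suc k)} (ℕ.s≤s (ℕ.s≤s ℕ.z≤n))) ⟩
    suc (suc k) ℕ.* 0                  ≡⟨ ℕ.*-zeroʳ (suc (suc k)) ⟩
    0                                  ≡⟨ cong (1 ℕ.*_) (k>n⇒nCk≡0 {0} {suc k} (ℕ.s≤s ℕ.z≤n)) ⟨
    1 ℕ.* (0 C suc k)                  ∎
  absorption (suc n) zero    = begin
    1 ℕ.* (suc (suc n) C 1)            ≡⟨ cong (1 ℕ.*_) (nC1≡n (suc (suc n))) ⟩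
    1 ℕ.* suc (suc n)                  ≡⟨ ℕ.*-comm 1 (suc (suc n)) ⟩
    suc (suc n) ℕ.* 1                  ∎
  absorption (suc n) (suc k) = begin
    suc (suc k) ℕ.* (suc (suc n) C suc (suc k))
      ≡⟨ cong (suc (suc k) ℕ.*_) (nCk+nC[k+1]≡[n+1]C[k+1] (suc n) (suc k)) ⟨
    suc (suc k) ℕ.* (c ℕ.+ (suc n C suc (suc k)))
      -- One copy of `c` is split off so that the remaining coefficients match the two induction
      -- hypotheses.
      ≡⟨ eq k c (suc n C suc (suc k)) ⟩
    c ℕ.+ (suc k ℕ.* c ℕ.+ suc (suc k) ℕ.* (suc n C suc (suc k)))
      ≡⟨ cong (c ℕ.+_) (cong₂ ℕ._+_ (absorption n k) (absorption n (suc k))) ⟩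
    c ℕ.+ (suc n ℕ.* (n C k) ℕ.+ suc n ℕ.* (n C suc k))
      ≡⟨ cong (c ℕ.+_) (ℕ.*-distribˡ-+ (suc n) (n C k) (n C suc k)) ⟨
    c ℕ.+ suc n ℕ.* ((n C k) ℕ.+ (n C suc k))
      ≡⟨ cong (λ x → c ℕ.+ suc n ℕ.* x) (nCk+nC[k+1]≡[n+1]C[k+1] n k) ⟩
    suc (suc n) ℕ.* c
      ∎
    where
    c = suc n C suc k
    eq : ∀ k c d → suc (suc k) ℕ.* (c ℕ.+ d) ≡ c ℕ.+ (suc k ℕ.* c ℕ.+ suc (suc k) ℕ.* d)
    eq = ℕ-Solver.solve-∀

  -- Symmetry replaces C(n+k, n-k) by C(n+k, 2k), to which absorption applies. The result is
  -- cross-multiplied to stay in ℕ.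
  nC[n-k]-absorption : ∀ {m j} → j ℕ.≤ m →
    suc j ℕ.* (((suc m ℕ.+ suc j) C (suc m ℕ.∸ suc j)) ℕ.* 2)
      ≡ (suc (m ℕ.+ j) C suc (j ℕ.+ j)) ℕ.* (suc m ℕ.+ suc j)
  nC[n-k]-absorption {m} {j} j≤m = begin
    suc j ℕ.* ((N C (n ℕ.∸ k)) ℕ.* 2)                   ≡⟨ cong (λ i → suc j ℕ.* ((N C i) ℕ.* 2)) index ⟨
    suc j ℕ.* ((N C (N ℕ.∸ (k ℕ.+ k))) ℕ.* 2)           ≡⟨ cong (λ c → suc j ℕ.* (c ℕ.* 2)) (nCk≡nC[n∸k] (ℕ.+-monoˡ-≤ k (ℕ.s≤s j≤m))) ⟨
    suc j ℕ.* ((N C (k ℕ.+ k)) ℕ.* 2)                   ≡⟨ cong₂ (λ a b → suc j ℕ.* ((suc a C suc b) ℕ.* 2)) (ℕ.+-suc m j) (ℕ.+-suc j j) ⟩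
    suc j ℕ.* (c ℕ.* 2)                                 ≡⟨ eq j c ⟩
    suc (suc (j ℕ.+ j)) ℕ.* c                           ≡⟨ absorption (suc (m ℕ.+ j)) (suc (j ℕ.+ j)) ⟩
    suc (suc (m ℕ.+ j)) ℕ.* (suc (m ℕ.+ j) C suc (j ℕ.+ j))  ≡⟨ cong (λ a → suc a ℕ.* (suc (m ℕ.+ j) C suc (j ℕ.+ j))) (ℕ.+-suc m j) ⟨
    N ℕ.* (suc (m ℕ.+ j) C suc (j ℕ.+ j))               ≡⟨ ℕ.*-comm N (suc (m ℕ.+ j) C suc (j ℕ.+ j)) ⟩
    (suc (m ℕ.+ j) C suc (j ℕ.+ j)) ℕ.* N               ∎
    where
    n = suc m
    k = suc j
    N = n ℕ.+ k
    c = suc (suc (m ℕ.+ j)) C suc (suc (j ℕ.+ j))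
    index : N ℕ.∸ (k ℕ.+ k) ≡ n ℕ.∸ k
    index = trans (sym (ℕ.∸-+-assoc N k k)) (cong (ℕ._∸ k) (ℕ.m+n∸n≡m n k))
    eq : ∀ j c → suc j ℕ.* (c ℕ.* 2) ≡ suc (suc (j ℕ.+ j)) ℕ.* c
    eq = ℕ-Solver.solve-∀

  -- Passage from rational to integer sums.

  fromℤ-* : ∀ i j → fromℤ (i · j) ≡ fromℤ i * fromℤ j
  fromℤ-* i j = ℚ.toℚᵘ-injective (ℚᵘ.≃-sym (ℚ.toℚᵘ-homo-* (fromℤ i) (fromℤ j)))

  fromℤ-+ : ∀ i j → fromℤ (i + j) ≡ fromℤ i ℚ.+ fromℤ j
  fromℤ-+ i j = ℚ.toℚᵘ-injective (ℚᵘ.≃-trans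
    (ℚᵘ.*≡* (cong (_· 1ℤ) (cong₂ _+_ (sym (ℤ.*-identityʳ i)) (sym (ℤ.*-identityʳ j)))))
    (ℚᵘ.≃-sym (ℚ.toℚᵘ-homo-+ (fromℤ i) (fromℤ j))))

  -- The quotient `i / d` is stored in lowest terms. Among unnormalised rationals it may be replaced
  -- by the raw fraction, where equality is cross-multiplication.
  /-*-fromℤ : ∀ i d .{{_ : ℕ.NonZero d}} {j z} → i · j ≡ z · + d → (i / d) * fromℤ j ≡ fromℤ z
  /-*-fromℤ i (suc d) {j} {z} ij≡zd = ℚ.toℚᵘ-injective
    (ℚᵘ.≃-trans (ℚ.toℚᵘ-homo-* (i / suc d) (fromℤ j))
    (ℚᵘ.≃-trans (ℚᵘ.*-congʳ {toℚᵘ (fromℤ j)} (ℚ.toℚᵘ-fromℚᵘ (ℚᵘ.mkℚᵘ i d)))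
    (ℚᵘ.*≡* (begin
      i · j · 1ℤ                 ≡⟨ ℤ.*-identityʳ (i · j) ⟩
      i · j                      ≡⟨ ij≡zd ⟩
      z · + suc d                ≡⟨ cong (λ x → z · + x) (ℕ.*-identityʳ (suc d)) ⟨
      z · + (suc d ℕ.* 1)        ∎))))

  -- Each summand of the theorem is half an integer, so doubling moves the whole sum into ℤ.
  double-sum : ∀ {N} (t : Fin N → ℚ) (g : Fin N → ℤ) →
    (∀ i → t i * fromℤ (+ 2) ≡ fromℤ (g i)) → ℚ-Sum.sum t * fromℤ (+ 2) ≡ fromℤ (sum g)
  double-sum {zero}  t g 2t≡g = refl
  double-sum {suc N} t g 2t≡g = begin
    (t₀ ℚ.+ Σt) * fromℤ (+ 2)                  ≡⟨ ℚ.*-distribʳ-+ (fromℤ (+ 2)) t₀ Σt ⟩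
    t₀ * fromℤ (+ 2) ℚ.+ Σt * fromℤ (+ 2)      ≡⟨ cong₂ ℚ._+_ (2t≡g Fin.zero) (double-sum (t ∘ Fin.suc) (g ∘ Fin.suc) (2t≡g ∘ Fin.suc)) ⟩
    fromℤ (g Fin.zero) ℚ.+ fromℤ (sum (g ∘ Fin.suc))  ≡⟨ fromℤ-+ (g Fin.zero) (sum (g ∘ Fin.suc)) ⟨
    fromℤ (sum g)                              ∎
    where
    t₀ = t Fin.zero
    Σt = ℚ-Sum.sum (t ∘ Fin.suc)

  ÷-fromℤ : ∀ {s} {d z} .{{_ : ℤ.NonZero d}} → s * fromℤ d ≡ fromℤ z → s ≡ fromℤ z ÷ fromℤ d
  ÷-fromℤ {s} {d} {z} sd≡z = begin
    s                                    ≡⟨ ℚ.*-identityʳ s ⟨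
    s * ℚ.1ℚ                             ≡⟨ cong (s *_) (ℚ.*-inverseʳ (fromℤ d)) ⟨
    s * (fromℤ d * 1/ fromℤ d)           ≡⟨ ℚ.*-assoc s (fromℤ d) (1/ fromℤ d) ⟨
    s * fromℤ d * 1/ fromℤ d             ≡⟨ cong (_* 1/ fromℤ d) sd≡z ⟩
    fromℤ z * 1/ fromℤ d                 ∎

  -- The sign `σ` and the integer factor `x` stay arbitrary, so that both sums are covered. The
  -- factor 2 is carried to the binomial coefficient, where absorption cancels the denominator n +
  -- k.
  double-term : ∀ {m j} → j ℕ.≤ m → ∀ σ x →
    fromℤ σ * (+ suc j / (suc m ℕ.+ suc j)) * fromℤ (+ ((suc m ℕ.+ suc j) C (suc m ℕ.∸ suc j)))
      * fromℤ x * fromℤ (+ 2)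
    ≡ fromℤ (σ · + (suc (m ℕ.+ j) C suc (j ℕ.+ j)) · x)
  double-term {m} {j} j≤m σ x = begin
    a * r * fromℤ (+ c) * fromℤ x * 2ℚ          ≡⟨ xy∙z≈xz∙y (a * r * fromℤ (+ c)) (fromℤ x) 2ℚ ⟩
    a * r * fromℤ (+ c) * 2ℚ * fromℤ x          ≡⟨ cong (_* fromℤ x) (ℚ.*-assoc (a * r) (fromℤ (+ c)) 2ℚ) ⟩
    a * r * (fromℤ (+ c) * 2ℚ) * fromℤ x        ≡⟨ cong (λ y → a * r * y * fromℤ x) (fromℤ-* (+ c) (+ 2)) ⟨
    a * r * fromℤ (+ c · + 2) * fromℤ x         ≡⟨ cong (_* fromℤ x) (ℚ.*-assoc a r (fromℤ (+ c · + 2))) ⟩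
    a * (r * fromℤ (+ c · + 2)) * fromℤ x       ≡⟨ cong (λ y → a * y * fromℤ x) (/-*-fromℤ (+ suc j) (suc m ℕ.+ suc j) absorb) ⟩
    a * fromℤ (+ c′) * fromℤ x                  ≡⟨ cong (_* fromℤ x) (fromℤ-* σ (+ c′)) ⟨
    fromℤ (σ · + c′) * fromℤ x                  ≡⟨ fromℤ-* (σ · + c′) x ⟨
    fromℤ (σ · + c′ · x)                        ∎
    where
    a = fromℤ σ
    r = + suc j / (suc m ℕ.+ suc j)
    c = (suc m ℕ.+ suc j) C (suc m ℕ.∸ suc j)
    c′ = suc (m ℕ.+ j) C suc (j ℕ.+ j)
    2ℚ = fromℤ (+ 2)
    absorb : + suc j · (+ c · + 2) ≡ + c′ · + (suc m ℕ.+ suc j)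
    absorb = begin
      + suc j · (+ c · + 2)            ≡⟨ cong (+ suc j ·_) (ℤ.pos-* c 2) ⟨
      + suc j · + (c ℕ.* 2)            ≡⟨ ℤ.pos-* (suc j) (c ℕ.* 2) ⟨
      + (suc j ℕ.* (c ℕ.* 2))          ≡⟨ cong +_ (nC[n-k]-absorption j≤m) ⟩
      + (c′ ℕ.* (suc m ℕ.+ suc j))     ≡⟨ ℤ.pos-* c′ (suc m ℕ.+ suc j) ⟩
      + c′ · + (suc m ℕ.+ suc j)       ∎

  module _ (ε y : ℤ) (ε²≡1 : ε · ε ≡ 1ℤ) where
    open Sums ε y ε²≡1

    -- Of F_p and L_p, `w` is the one in the denominator and `x` the one extracted from the odd
    -- powers. Clearing `2w` leaves the product `w · x · S m`.
    sum-quotient : ∀ m (t : ℕ → ℚ) x w z .{{_ : ℤ.NonZero (+ 2 · w)}} →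
      (∀ {j} → j ℕ.≤ m → t (suc j) * fromℤ (+ 2) ≡ fromℤ (x · odd m j)) →
      w · x · S m ≡ z → ∑₁ (suc m) t ≡ fromℤ z ÷ fromℤ (+ 2 · w)
    sum-quotient m t x w z 2t≡ wxS≡z = ÷-fromℤ {d = + 2 · w} (begin
      s * fromℤ (+ 2 · w)                ≡⟨ cong (s *_) (fromℤ-* (+ 2) w) ⟩
      s * (fromℤ (+ 2) * fromℤ w)        ≡⟨ ℚ.*-assoc s (fromℤ (+ 2)) (fromℤ w) ⟨
      s * fromℤ (+ 2) * fromℤ w          ≡⟨ cong (_* fromℤ w) (double-sum {suc m} (t ∘ suc ∘ toℕ) (λ i → x · odd m (toℕ i)) (λ i → 2t≡ (ℕ.≤-pred (Fin.toℕ<n i)))) ⟩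
      fromℤ (sum {suc m} (λ i → x · odd m (toℕ i))) * fromℤ w  ≡⟨ cong (λ u → fromℤ u * fromℤ w) (*-distribˡ-sum {suc m} x (odd m ∘ toℕ)) ⟨
      fromℤ (x · S m) * fromℤ w          ≡⟨ fromℤ-* (x · S m) w ⟨
      fromℤ (x · S m · w)                ≡⟨ cong fromℤ (trans (eq x (S m) w) wxS≡z) ⟩
      fromℤ z                            ∎)
      where
      s = ∑₁ (suc m) t
      eq : ∀ x u w → x · u · w ≡ w · x · u
      eq = solve-∀

-- Specialisation to the Lucas and the Fibonacci sum.

theorem15 : (n : ℕ) .{{_ : ℕ.NonZero n}} (p : ℤ) →
    ((p≢0 : p ≢ 0ℤ) →
    let instance _ = 2F-nonZero p≢0 in
    (∑[1≤ k ≤ n ]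
    (let instance _ = +-nonZeroˡ n k in
    fromℤ ([-1]^ ((p ℤ.- 1ℤ) ℤ.* (+ n ℤ.- + k)))
    * (+ k / (n ℕ.+ k))
    * fromℤ (+ ((n ℕ.+ k) C (n ℕ.∸ k)))
    * fromℤ (L p ℤ.^ (2 ℕ.* k ℕ.∸ 1))))
    ≡ fromℤ (F (+ 2 ℤ.* + n ℤ.* p)) ÷ fromℤ (+ 2 ℤ.* F p))
    ×
    (let instance _ = 2L-nonZero p in
    (∑[1≤ k ≤ n ]
    (let instance _ = +-nonZeroˡ n k in
    fromℤ ([-1]^ (p ℤ.* (+ n ℤ.- + k)))
    * (+ k / (n ℕ.+ k))
    * fromℤ (+ ((n ℕ.+ k) C (n ℕ.∸ k)))
    * fromℤ ((+ 5) ℤ.^ (k ℕ.∸ 1))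
    * fromℤ (F p ℤ.^ (2 ℕ.* k ℕ.∸ 1))))
    ≡ fromℤ (F (+ 2 ℤ.* + n ℤ.* p)) ÷ fromℤ (+ 2 ℤ.* L p))
theorem15 (suc m) p = lucas , fibonacci
  where
  open Data.Integer.Base using (_+_; _-_; -_; _^_) renaming (_*_ to _·_)
  n = suc m
  q = ∣ p ∣

  lucas : (p≢0 : p ≢ 0ℤ) → _
  lucas p≢0 = sum-quotient ε (L p ^ 2) ε²≡1 m t (L p) (F p) _ {{2F-nonZero p≢0}}
    term (S-F ε (L p ^ 2) ε²≡1 p trace m)
    where
    ε = [-1]^ (p - 1ℤ)
    t : ℕ → ℚ
    t k = fromℤ ([-1]^ ((p - 1ℤ) · (+ n - + k))) * (+ k / (n ℕ.+ k))
          * fromℤ (+ ((n ℕ.+ k) C (n ℕ.∸ k))) * fromℤ (L p ^ (2 ℕ.* k ℕ.∸ 1))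
    ε²≡1 = involution-^ { -1ℤ} refl ∣ p - 1ℤ ∣
    open Sums ε (L p ^ 2) ε²≡1 using (odd)
    trace : L p ^ 2 + (ε + ε) ≡ lℤ (q ℕ.+ q)
    -- Here ε = -(-1)^p, so y + 2ε is L_q² - 2(-1)^q.
    trace = trans (cong₂ (λ l s → l + (s + s)) (L²-abs p) (sign-pred p)) (lℤ²-sign q)
    eq : ∀ e c x z → e · c · (x · z) ≡ x · (e · c · z)
    eq = solve-∀
    term : ∀ {j} → j ℕ.≤ m → t (suc j) * fromℤ (+ 2) ≡ fromℤ (L p · odd m j)
    term {j} j≤m = trans
      (double-term j≤m ([-1]^ ((p - 1ℤ) · (+ n - + suc j))) (L p ^ (2 ℕ.* suc j ℕ.∸ 1)))
      (cong fromℤ (trans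
        (cong₂ (λ e x → e · + (suc (m ℕ.+ j) C suc (j ℕ.+ j)) · x) (sign-quotient (p - 1ℤ) j≤m) (odd-power (L p) j))
        (eq (ε ^ (m ℕ.+ j)) (+ (suc (m ℕ.+ j) C suc (j ℕ.+ j))) (L p) ((L p ^ 2) ^ j))))

  fibonacci : _
  fibonacci = sum-quotient ε (+ 5 · F p ^ 2) ε²≡1 m t (F p) (L p) _ {{2L-nonZero p}}
    term (trans (cong (_· S m) (ℤ.*-comm (L p) (F p))) (S-F ε (+ 5 · F p ^ 2) ε²≡1 p trace m))
    where
    ε = [-1]^ p
    a t : ℕ → ℚ
    a k = fromℤ ([-1]^ (p · (+ n - + k))) * (+ k / (n ℕ.+ k)) * fromℤ (+ ((n ℕ.+ k) C (n ℕ.∸ k)))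
    t k = a k * fromℤ ((+ 5) ^ (k ℕ.∸ 1)) * fromℤ (F p ^ (2 ℕ.* k ℕ.∸ 1))
    ε²≡1 = involution-^ { -1ℤ} refl q
    open Sums ε (+ 5 · F p ^ 2) ε²≡1 using (S; odd)
    trace : + 5 · F p ^ 2 + (ε + ε) ≡ lℤ (q ℕ.+ q)
    trace = trans (cong (λ a → + 5 · a + (ε + ε)) (F²-abs p)) (5fℤ²+sign q)
    eq : ∀ e c f x z → e · c · (f · (x · z)) ≡ x · (e · c · (f · z))
    eq = solve-∀
    term : ∀ {j} → j ℕ.≤ m → t (suc j) * fromℤ (+ 2) ≡ fromℤ (F p · odd m j)
    term {j} j≤m = begin
      -- The powers of 5 and of F_p are merged into the single integer factor that `double-term`
      -- expects.
      a (suc j) * fromℤ ((+ 5) ^ j) * fromℤ X * fromℤ (+ 2)    ≡⟨ cong (_* fromℤ (+ 2)) (trans (ℚ.*-assoc (a (suc j)) (fromℤ ((+ 5) ^ j)) (fromℤ X)) (cong (a (suc j) *_) (sym (fromℤ-* ((+ 5) ^ j) X)))) ⟩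
      a (suc j) * fromℤ ((+ 5) ^ j · X) * fromℤ (+ 2)          ≡⟨ double-term j≤m ([-1]^ (p · (+ n - + suc j))) ((+ 5) ^ j · X) ⟩
      fromℤ ([-1]^ (p · (+ n - + suc j)) · c · ((+ 5) ^ j · X))
        ≡⟨ cong fromℤ (cong₂ (λ e x → e · c · ((+ 5) ^ j · x)) (sign-quotient p j≤m) (odd-power (F p) j)) ⟩
      fromℤ (ε ^ (m ℕ.+ j) · c · ((+ 5) ^ j · (F p · (F p ^ 2) ^ j)))
        ≡⟨ cong fromℤ (eq (ε ^ (m ℕ.+ j)) c ((+ 5) ^ j) (F p) ((F p ^ 2) ^ j)) ⟩
      fromℤ (F p · (ε ^ (m ℕ.+ j) · c · ((+ 5) ^ j · (F p ^ 2) ^ j)))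
        ≡⟨ cong (λ x → fromℤ (F p · (ε ^ (m ℕ.+ j) · c · x))) (^-distrib-· (+ 5) (F p ^ 2) j) ⟨
      fromℤ (F p · (ε ^ (m ℕ.+ j) · c · (+ 5 · F p ^ 2) ^ j))
        ∎
      where
      X = F p ^ (2 ℕ.* suc j ℕ.∸ 1)
      c = + (suc (m ℕ.+ j) C suc (j ℕ.+ j))
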